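{- For every finite set $\mathrm{Prop}$ of propositional variables, the concept class $\mathbb{C}(\mathcal{F}_{\mathrm{fin}},\mathcal{L}_{\Box,\Diamond,\wedge,\vee}[\mathrm{Prop}])$ admits finite characterisations, i.e. every formula $\varphi\in\mathcal{L}_{\Box,\Diamond,\wedge,\vee}[\mathrm{Prop}]$ has a finite characterisation with respect to this concept class. Moreover, these characterisations are effectively computable: there is an algorithm that, given $\varphi\in\mathcal{L}_{\Box,\Diamond,\wedge,\vee}[\mathrm{Prop}]$, outputs a finite characterisation of $\varphi$.
   Context: $\mathcal{L}_{\Box,\Diamond,\wedge,\vee}[\mathrm{Prop}]$ is the set of modal formulas generated from the propositional variables $p\in\mathrm{Prop}$ using only $\Box,\Diamond$ and binary $\wedge,\vee$ (in particular without $\top$, $\bot$ and negation). A Kripke model over $\mathrm{Prop}$ is $M=(dom(M),R,v)$ with $R\subseteq dom(M)\times dom(M)$ and $v:dom(M)\to\mathcal{P}(\mathrm{Prop})$; its frame is $(dom(M),R)$; a pointed model is a pair $(M,s)$ with $s\in dom(M)$. Satisfaction $M,s\models\varphi$ is the standard Kripke semantics ($M,s\models p$ iff $p\in v(s)$). $\mathcal{F}_{\mathrm{fin}}$ is the class of all finite frames. For a class $\mathcal{F}$ of frames and a set $\mathcal{L}[\mathrm{Prop}]$ of modal formulas, $\mathbb{C}(\mathcal{F},\mathcal{L}[\mathrm{Prop}])$ is the concept class whose examples are the pointed models over $\mathrm{Prop}$ whose frame is in $\mathcal{F}$, whose concepts are the formulas in $\mathcal{L}[\mathrm{Prop}]$,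 and in which an example $(M,s)$ is positive for $\varphi$ if $M,s\models\varphi$ and negative otherwise. A formula $\varphi$ fits a pair $(E^+,E^-)$ of finite sets of examples if every element of $E^+$ is a positive example and every element of $E^-$ is a negative example for $\varphi$. A finite characterisation of $\varphi$ with respect to this concept class is a pair $(E^+,E^-)$ of finite sets of examples such that $\varphi$ fits $(E^+,E^-)$ and every $\psi\in\mathcal{L}[\mathrm{Prop}]$ that fits $(E^+,E^-)$ has the same positive examples as $\varphi$. The concept class admits finite characterisations if each of its formulas has one. -}

module Defs where

open import Data.Nat using (ℕ)
open import Data.Fin using (Fin)
open import Data.Fin.Subset using (Subset; _∈_)
open import Data.List using (List)
open import Data.List.Relation.Unary.All using (All)
open import Data.Product using (Σ-syntax; ∃; _×_; proj₁; proj₂)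
open import Data.Sum using (_⊎_)
open import Function.Bundles using (_⇔_)
open import Relation.Nullary using (¬_)

record ConceptClass : Set₁ where
  field
    Example  : Set
    Concept  : Set
    Positive : Example → Concept → Set

module _ (C : ConceptClass) where
  open ConceptClass C

  -- A pair (E⁺ , E⁻) of finite sets, each given by a list of its elements.
  LabelledExamples : Set
  LabelledExamples = List Example × List Example

  Fits : Concept → LabelledExamples → Set
  Fits φ E = All (λ e → Positive e φ) (proj₁ E)
           × All (λ e → ¬ Positive e φ) (proj₂ E)

  SamePositives : Concept → Concept → Set
  SamePositives φ ψ = ∀ (e : Example) → Positive e φ ⇔ Positive e ψ

  IsFiniteCharacterisation : Concept → LabelledExamples → Set
  IsFiniteCharacterisation φ E =
    Fits φ E × (∀ (ψ : Concept) → Fits ψ E → SamePositives ψ φ)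

  AdmitsFiniteCharacterisations : Set
  AdmitsFiniteCharacterisations =
    ∀ (φ : Concept) → ∃ λ E → IsFiniteCharacterisation φ E

  -- An algorithm is a function definable in axiom-free Agda: on a closed
  -- concept it evaluates to two explicit lists of examples.
  EffectivelyCharacterisable : Set
  EffectivelyCharacterisable =
    Σ[ characterise ∈ (Concept → LabelledExamples) ]
      (∀ (φ : Concept) → IsFiniteCharacterisation φ (characterise φ))

infix  9 □_ ◇_
infixr 7 _∧_
infixr 6 _∨_

-- The set Prop of propositional variables is Fin k.
data Formula (k : ℕ) : Set where
  var     : Fin k → Formula k
  _∧_ _∨_ : Formula k → Formula k → Formula k
  □_ ◇_   : Formula k → Formula k

-- Domains are Fin size.  Both the accessibility relation (as successor sets)
-- and the valuation use the boolean-valued Subset, so a model is finite data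
-- and classical finite frames are represented up to isomorphism.
record FiniteFrame : Set where
  field
    size       : ℕ
    successors : Fin size → Subset size

  World : Set
  World = Fin size

  R : World → World → Set
  R s t = t ∈ successors s

record FiniteModel (k : ℕ) : Set where
  field
    frame : FiniteFrame
  open FiniteFrame frame public
  field
    v : World → Subset k

record PointedModel (k : ℕ) : Set where
  constructor _,_
  field
    model : FiniteModel k
    point : FiniteModel.World model

infix 4 _⊩_⊨_

_⊩_⊨_ : ∀ {k} (M : FiniteModel k) → FiniteModel.World M → Formula k → Set
M ⊩ s ⊨ var p   = p ∈ FiniteModel.v M s
M ⊩ s ⊨ (φ ∧ ψ) = (M ⊩ s ⊨ φ) × (M ⊩ s ⊨ ψ)
M ⊩ s ⊨ (φ ∨ ψ) = (M ⊩ s ⊨ φ) ⊎ (M ⊩ s ⊨ ψ)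
M ⊩ s ⊨ (□ φ)   = ∀ t → FiniteModel.R M s t → M ⊩ t ⊨ φ
M ⊩ s ⊨ (◇ φ)   = ∃ λ t → FiniteModel.R M s t × (M ⊩ t ⊨ φ)

-- ℂ(𝓕fin , 𝓛[□,◇,∧,∨][Fin k])
ℂfin : ℕ → ConceptClass
ℂfin k = record
  { Example  = PointedModel k
  ; Concept  = Formula k
  ; Positive = λ e φ → PointedModel.model e ⊩ PointedModel.point e ⊨ φ
  }

{-# OPTIONS --safe #-}

-- Unravel a pointed model to depth d and end every branch in a reflexive world
-- whose valuation is empty (⟳∅) or full (⟳Prop).  ⟳∅ satisfies no formula and
-- ⟳Prop satisfies all of them, so every formula true at the ∅-unravelling is
-- true at the original point, every formula true at the original point is true
-- at the Prop-unravelling, and all three agree on formulas of rank at most d.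
-- Up to bisimulation there are only finitely many unravellings of depth d; they
-- all live in one finite model.  Those ending in ⟳∅ that satisfy φ and those
-- ending in ⟳Prop that refute φ therefore characterise φ.
module Submission where

open import Defs
open import Data.Bool using (true)
open import Data.Fin using (Fin; zero; _↑ˡ_; _↑ʳ_; _≟_; splitAt; combine; remQuot; finToFun; funToFin)
open import Data.Fin.Properties using (any?; all?; 2↔Bool; finToFun-funToFin; splitAt-↑ˡ; splitAt-↑ʳ; remQuot-combine)
open import Data.Fin.Subset using (Subset; Side; inside; outside; ⊤; _∈_)
open import Data.Fin.Subset.Properties using (_∈?_; ∈⊤; ∉⊥)
open import Data.List as List using (List; filter; allFin)
open import Data.List.Membership.Propositional using () renaming (_∈_ to _∈ˡ_)
open import Data.List.Membership.Propositional.Properties using (∈-map⁺; ∈-filter⁺; ∈-allFin)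
open import Data.List.Relation.Unary.All using (lookup)
open import Data.List.Relation.Unary.All.Properties using (all-filter)
open import Data.Nat using (ℕ; zero; suc; _+_; _*_; _^_; _⊔_; _≤_; _<_; z<s; s≤s⁻¹)
open import Data.Nat.Properties using (≤-refl; <⇒≱; m<n⇒m<n⊔o; m⊔n≤o⇒m≤o; m⊔n≤o⇒n≤o)
open import Data.Product as Product using (∃; _×_; _,_; proj₁; proj₂)
open import Data.Sum as Sum using (_⊎_; inj₁; inj₂; [_,_]′; map₁)
open import Data.Vec as Vec using (tabulate; replicate)
open import Data.Vec.Properties using ([]=⇒lookup; lookup⇒[]=; lookup∘tabulate; tabulate∘lookup; tabulate-cong)
open import Function using (_∘_; _⇔_; mk⇔; Equivalence; Inverse)
open import Relation.Binary.PropositionalEquality using (_≡_; refl; sym; trans; cong; cong₂; subst)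
open import Relation.Nullary using (¬_; Dec; yes; does; ¬?; contradiction)
open import Relation.Nullary.Decidable using (dec-true; _×-dec_; _⊎-dec_; _→-dec_; decidable-stable)

open Equivalence using (to; from)
open FiniteModel using (World; R; v; size; successors)

private
  variable
    k m n : ℕ

satisfies? : ∀ (φ : Formula k) M (s : World M) → Dec (M ⊩ s ⊨ φ)
satisfies? (var p) M s = p ∈? v M s
satisfies? (φ ∧ ψ) M s = satisfies? φ M s ×-dec satisfies? ψ M s
satisfies? (φ ∨ ψ) M s = satisfies? φ M s ⊎-dec satisfies? ψ M s
satisfies? (□ φ)   M s = all? λ t → (t ∈? successors M s) →-dec satisfies? φ M t
satisfies? (◇ φ)   M s = any? λ t → (t ∈? successors M s) ×-dec satisfies? φ M t

image : (Fin m → Fin n) → Subset m → Subset n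
image f S = tabulate λ u → does (any? λ t → (t ∈? S) ×-dec (u ≟ f t))

∈-image : ∀ (f : Fin m → Fin n) S {u} → u ∈ image f S ⇔ (∃ λ t → t ∈ S × u ≡ f t)
∈-image f S {u} = mk⇔ (member ∘ trans (sym (lookup∘tabulate _ u)) ∘ []=⇒lookup)
                      (lookup⇒[]= u _ ∘ trans (lookup∘tabulate _ u) ∘ dec-true (any? _))
  where
  member : does (any? λ t → (t ∈? S) ×-dec (u ≟ f t)) ≡ true → ∃ λ t → t ∈ S × u ≡ f t
  member eq with yes ∃t ← any? (λ t → (t ∈? S) ×-dec (u ≟ f t)) = ∃t

-- Worlds have to be elements of some `Fin`, so subsets are numbered through their characteristic
-- functions. This lets a new world of `extend` stand for a valuation and a successor set.
decode : Fin (2 ^ n) → Subset n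
decode c = tabulate (Inverse.to 2↔Bool ∘ finToFun c)

encode : Subset n → Fin (2 ^ n)
encode S = funToFin (Inverse.from 2↔Bool ∘ Vec.lookup S)

decode-encode : (S : Subset n) → decode (encode S) ≡ S
decode-encode S = trans (tabulate-cong λ i → Inverse.inverseˡ 2↔Bool (finToFun-funToFin _ i))
                        (tabulate∘lookup S)

-- The equation on successors yields both the forth condition `R⁺` and the back condition `R⁻`, so
-- the graph of `f` is a bisimulation.
⊨-pmorphism : ∀ (M N : FiniteModel k) (f : World M → World N) →
              (∀ s → v N (f s) ≡ v M s) →
              (∀ s → successors N (f s) ≡ image f (successors M s)) →
              ∀ φ s → M ⊩ s ⊨ φ ⇔ N ⊩ f s ⊨ φ
⊨-pmorphism M N f v-f succ-f φ s = mk⇔ (preserve φ s) (reflect φ s)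
  where
  R⁺ : ∀ {s t} → R M s t → R N (f s) (f t)
  R⁺ {s} {t} Rst = subst (f t ∈_) (sym (succ-f s)) (from (∈-image f _) (t , Rst , refl))

  R⁻ : ∀ {s u} → R N (f s) u → ∃ λ t → R M s t × u ≡ f t
  R⁻ {s} {u} Rsu = to (∈-image f _) (subst (u ∈_) (succ-f s) Rsu)

  preserve : ∀ φ s → M ⊩ s ⊨ φ → N ⊩ f s ⊨ φ
  preserve (var p) s h = subst (p ∈_) (sym (v-f s)) h
  preserve (φ ∧ ψ) s (h , h′) = preserve φ s h , preserve ψ s h′
  preserve (φ ∨ ψ) s = Sum.map (preserve φ s) (preserve ψ s)
  preserve (□ φ) s h u Rsu with t , Rst , refl ← R⁻ Rsu = preserve φ t (h t Rst)
  preserve (◇ φ) s (t , Rst , h) = f t , R⁺ Rst , preserve φ t h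

  reflect : ∀ φ s → N ⊩ f s ⊨ φ → M ⊩ s ⊨ φ
  reflect (var p) s h = subst (p ∈_) (v-f s) h
  reflect (φ ∧ ψ) s (h , h′) = reflect φ s h , reflect ψ s h′
  reflect (φ ∨ ψ) s = Sum.map (reflect φ s) (reflect ψ s)
  reflect (□ φ) s h t Rst = reflect φ t (h (f t) (R⁺ Rst))
  reflect (◇ φ) s (u , Rsu , h) with t , Rst , refl ← R⁻ Rsu = t , Rst , reflect φ t h

loop : Side → FiniteModel k
loop {k} b = record
  { frame = record { size = 1 ; successors = λ _ → ⊤ }
  ; v     = λ _ → replicate k b
  }

loop-inside : ∀ (φ : Formula k) s → loop inside ⊩ s ⊨ φ
loop-inside (var p) s = ∈⊤
loop-inside (φ ∧ ψ) s = loop-inside φ s , loop-inside ψ s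
loop-inside (φ ∨ ψ) s = inj₁ (loop-inside φ s)
loop-inside (□ φ)   s = λ t _ → loop-inside φ t
loop-inside (◇ φ)   s = zero , ∈⊤ , loop-inside φ zero

loop-outside : ∀ (φ : Formula k) s → ¬ (loop outside ⊩ s ⊨ φ)
loop-outside (var p) s h = ∉⊥ h
loop-outside (φ ∧ ψ) s (h , _) = loop-outside φ s h
loop-outside (φ ∨ ψ) s = [ loop-outside φ s , loop-outside ψ s ]′
-- Reflexivity matters here: a dead end would satisfy every box vacuously.
loop-outside (□ φ)   s h = loop-outside φ zero (h zero ∈⊤)
loop-outside (◇ φ)   s (t , _ , h) = loop-outside φ t h

-- extend M adds to M one new world for every choice of a valuation and a set of
-- successors in M.
module _ {k} (M : FiniteModel k) where

  newWorlds : ℕ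
  newWorlds = 2 ^ k * 2 ^ size M

  -- New worlds, like old ones, see only old worlds, so a subset of `World M` records the successors
  -- of either kind.
  profile : World M ⊎ Fin newWorlds → Subset k × Subset (size M)
  profile (inj₁ s) = v M s , successors M s
  profile (inj₂ c) = Product.map decode decode (remQuot (2 ^ size M) c)

  old : World M → Fin (size M + newWorlds)
  old s = s ↑ˡ newWorlds

  extend : FiniteModel k
  extend = record
    { frame = record
      { size       = size M + newWorlds
      ; successors = image old ∘ proj₂ ∘ profile ∘ splitAt (size M)
      }
    ; v = proj₁ ∘ profile ∘ splitAt (size M)
    }

  new : Subset k → Subset (size M) → World extend
  new V S = size M ↑ʳ combine (encode V) (encode S)

  profile-old : ∀ s → profile (splitAt (size M) (old s)) ≡ (v M s , successors M s)
  profile-old s = cong profile (splitAt-↑ˡ (size M) s newWorlds)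

  profile-new : ∀ V S → profile (splitAt (size M) (new V S)) ≡ (V , S)
  profile-new V S =
    trans (cong profile (splitAt-↑ʳ (size M) newWorlds (combine (encode V) (encode S))))
    (trans (cong (Product.map decode decode) (remQuot-combine (encode V) (encode S)))
           (cong₂ _,_ (decode-encode V) (decode-encode S)))

  -- No arrow leaves the old worlds, so `M` sits in `extend` as a generated submodel.
  ⊨-old : ∀ φ s → M ⊩ s ⊨ φ ⇔ extend ⊩ old s ⊨ φ
  ⊨-old = ⊨-pmorphism M extend old (cong proj₁ ∘ profile-old)
                      (cong (image old ∘ proj₂) ∘ profile-old)

  ∈-new : ∀ V S {p} → p ∈ v extend (new V S) ⇔ p ∈ V
  ∈-new V S {p} = mk⇔ (subst (p ∈_) eq) (subst (p ∈_) (sym eq))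
    where eq = cong proj₁ (profile-new V S)

  R-new : ∀ V S {u} → R extend (new V S) u ⇔ (∃ λ t → t ∈ S × u ≡ old t)
  R-new V S {u} = mk⇔ (to (∈-image old S) ∘ subst (u ∈_) eq)
                          (subst (u ∈_) (sym eq) ∘ from (∈-image old S))
    where eq = cong (image old ∘ proj₂) (profile-new V S)

-- It depends only on the leaf and the depth, not on the model to be unravelled; this is why
-- finitely many examples can test all models.
unravellings : Side → ℕ → FiniteModel k
unravellings b zero    = loop b
unravellings b (suc d) = extend (unravellings b d)

-- Modal depth plus one: the looping worlds at depth 0 need not even agree with
-- the original model on propositional variables.
rank : Formula k → ℕ
rank (var p) = 1
rank (φ ∧ ψ) = rank φ ⊔ rank ψ
rank (φ ∨ ψ) = rank φ ⊔ rank ψ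
rank (□ φ)   = suc (rank φ)
rank (◇ φ)   = suc (rank φ)

rank-positive : (φ : Formula k) → 0 < rank φ
rank-positive (var p) = z<s
rank-positive (φ ∧ ψ) = m<n⇒m<n⊔o (rank ψ) (rank-positive φ)
rank-positive (φ ∨ ψ) = m<n⇒m<n⊔o (rank ψ) (rank-positive φ)
rank-positive (□ φ)   = z<s
rank-positive (◇ φ)   = z<s

module _ {k} (b : Side) (M : FiniteModel k) where

  -- Successors with equal unravellings are merged, because `unravelAll` collects them in a set.
  unravel    : ∀ d → World M → World (unravellings {k} b d)
  unravelAll : ∀ d → World M → Subset (size (unravellings {k} b d))

  unravel zero    s = zero
  unravel (suc d) s = new (unravellings b d) (v M s) (unravelAll d s)

  unravelAll d s = image (unravel d) (successors M s)

  unravelOld : ∀ d → World M → World (unravellings {k} b (suc d))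
  unravelOld d = old (unravellings b d) ∘ unravel d

  R-unravel⁺ : ∀ d {s t} → R M s t → R (unravellings b (suc d)) (unravel (suc d) s) (unravelOld d t)
  R-unravel⁺ d {s} {t} Rst =
    from (R-new (unravellings b d) (v M s) (unravelAll d s))
         (unravel d t , from (∈-image _ _) (t , Rst , refl) , refl)

  R-unravel⁻ : ∀ d {s u} → R (unravellings b (suc d)) (unravel (suc d) s) u →
               ∃ λ t → R M s t × u ≡ unravelOld d t
  R-unravel⁻ d {s} Rsu
    with _ , w∈S , refl ← to (R-new (unravellings b d) (v M s) (unravelAll d s)) Rsu
    with t , Rst , refl ← to (∈-image (unravel d) _) w∈S
    = t , Rst , refl

  -- If the rank is at most `d`, the evaluation never reaches a leaf; if `b` is `inside`, a leaf
  -- makes everything true. Without negation, truth can be pushed in this direction alone.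
  ⊨-unravel⁺ : ∀ d φ s → rank φ ≤ d ⊎ b ≡ inside →
               M ⊩ s ⊨ φ → unravellings b d ⊩ unravel d s ⊨ φ
  ⊨-unravel⁺ zero φ s (inj₁ r≤0) h = contradiction r≤0 (<⇒≱ (rank-positive φ))
  ⊨-unravel⁺ zero φ s (inj₂ refl) h = loop-inside φ zero
  ⊨-unravel⁺ (suc d) (var p) s c h = from (∈-new (unravellings b d) (v M s) (unravelAll d s)) h
  ⊨-unravel⁺ (suc d) (φ ∧ ψ) s c (h , h′) =
    ⊨-unravel⁺ (suc d) φ s (map₁ (m⊔n≤o⇒m≤o _ _) c) h ,
    ⊨-unravel⁺ (suc d) ψ s (map₁ (m⊔n≤o⇒n≤o (rank φ) _) c) h′
  ⊨-unravel⁺ (suc d) (φ ∨ ψ) s c =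
    Sum.map (⊨-unravel⁺ (suc d) φ s (map₁ (m⊔n≤o⇒m≤o _ _) c))
            (⊨-unravel⁺ (suc d) ψ s (map₁ (m⊔n≤o⇒n≤o (rank φ) _) c))
  ⊨-unravel⁺ (suc d) (□ φ) s c h u Rsu with t , Rst , refl ← R-unravel⁻ d Rsu =
    -- The induction hypothesis lives one stage lower, and `⊨-old` lifts it to the current stage.
    to (⊨-old (unravellings b d) φ _) (⊨-unravel⁺ d φ t (map₁ s≤s⁻¹ c) (h t Rst))
  ⊨-unravel⁺ (suc d) (◇ φ) s c (t , Rst , h) =
    unravelOld d t , R-unravel⁺ d Rst ,
    to (⊨-old (unravellings b d) φ _) (⊨-unravel⁺ d φ t (map₁ s≤s⁻¹ c) h)

  -- Dually, an `outside` leaf satisfies nothing, so truth at the unravelling cannot come from the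
  -- leaves.
  ⊨-unravel⁻ : ∀ d φ s → rank φ ≤ d ⊎ b ≡ outside →
               unravellings b d ⊩ unravel d s ⊨ φ → M ⊩ s ⊨ φ
  ⊨-unravel⁻ zero φ s (inj₁ r≤0) h = contradiction r≤0 (<⇒≱ (rank-positive φ))
  ⊨-unravel⁻ zero φ s (inj₂ refl) h = contradiction h (loop-outside φ zero)
  ⊨-unravel⁻ (suc d) (var p) s c h = to (∈-new (unravellings b d) (v M s) (unravelAll d s)) h
  ⊨-unravel⁻ (suc d) (φ ∧ ψ) s c (h , h′) =
    ⊨-unravel⁻ (suc d) φ s (map₁ (m⊔n≤o⇒m≤o _ _) c) h ,
    ⊨-unravel⁻ (suc d) ψ s (map₁ (m⊔n≤o⇒n≤o (rank φ) _) c) h′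
  ⊨-unravel⁻ (suc d) (φ ∨ ψ) s c =
    Sum.map (⊨-unravel⁻ (suc d) φ s (map₁ (m⊔n≤o⇒m≤o _ _) c))
            (⊨-unravel⁻ (suc d) ψ s (map₁ (m⊔n≤o⇒n≤o (rank φ) _) c))
  ⊨-unravel⁻ (suc d) (□ φ) s c h t Rst =
    ⊨-unravel⁻ d φ t (map₁ s≤s⁻¹ c)
      (from (⊨-old (unravellings b d) φ _) (h (unravelOld d t) (R-unravel⁺ d Rst)))
  ⊨-unravel⁻ (suc d) (◇ φ) s c (u , Rsu , h) with t , Rst , refl ← R-unravel⁻ d Rsu =
    t , Rst , ⊨-unravel⁻ d φ t (map₁ s≤s⁻¹ c) (from (⊨-old (unravellings b d) φ _) h)

Satisfies : Formula k → PointedModel k → Set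
Satisfies φ (M , s) = M ⊩ s ⊨ φ

_⊨?_ : ∀ (e : PointedModel k) φ → Dec (Satisfies φ e)
(M , s) ⊨? φ = satisfies? φ M s

pointedUnravellings : Side → ℕ → List (PointedModel k)
pointedUnravellings b d = List.map (unravellings b d ,_) (allFin _)

∈-pointedUnravellings : ∀ b d (w : World (unravellings {k} b d)) →
                        (unravellings b d , w) ∈ˡ pointedUnravellings b d
∈-pointedUnravellings b d w = ∈-map⁺ _ (∈-allFin w)

-- Labelling each world by the truth value of `φ` there makes `φ` fit by construction.
characterise : Formula k → LabelledExamples (ℂfin k)
characterise φ = filter (_⊨? φ) (pointedUnravellings outside (rank φ))
               , filter (¬? ∘ (_⊨? φ)) (pointedUnravellings inside (rank φ))

characterise-correct : (φ : Formula k) → IsFiniteCharacterisation (ℂfin k) φ (characterise φ)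
characterise-correct φ = fits , unique
  where
  d = rank φ

  fits : Fits (ℂfin _) φ (characterise φ)
  fits = all-filter (_⊨? φ) (pointedUnravellings outside d)
       , all-filter (¬? ∘ (_⊨? φ)) (pointedUnravellings inside d)

  unique : ∀ ψ → Fits (ℂfin _) ψ (characterise φ) → SamePositives (ℂfin _) ψ φ
  unique ψ (pos , neg) (M , s) = mk⇔ ψ⇒φ φ⇒ψ
    where
    φ⇒ψ : M ⊩ s ⊨ φ → M ⊩ s ⊨ ψ
    -- The rank of `ψ` may exceed `d`, so `ψ` can move only in the direction that the leaf allows,
    -- while `φ` moves by its rank.
    φ⇒ψ h = ⊨-unravel⁻ outside M d ψ s (inj₂ refl)
      (lookup pos (∈-filter⁺ (_⊨? φ) (∈-pointedUnravellings outside d _)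
        (⊨-unravel⁺ outside M d φ s (inj₁ ≤-refl) h)))

    ψ⇒φ : M ⊩ s ⊨ ψ → M ⊩ s ⊨ φ
    -- If `φ` failed at `s`, the unravelling with full leaves would be a negative example, yet `ψ`
    -- would hold there.
    ψ⇒φ h = decidable-stable (satisfies? φ M s) λ ¬h →
      lookup neg (∈-filter⁺ (¬? ∘ (_⊨? φ)) (∈-pointedUnravellings inside d _)
        (¬h ∘ ⊨-unravel⁻ inside M d φ s (inj₁ ≤-refl)))
      (⊨-unravel⁺ inside M d ψ s (inj₂ refl) h)

theorem3p10 : (k : ℕ) → AdmitsFiniteCharacterisations (ℂfin k) × EffectivelyCharacterisable (ℂfin k)
theorem3p10 k = (λ φ → characterise φ , characterise-correct φ) , (characterise , characterise-correct)
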